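{- The set $\{1234,2143,3412,4321\}$ of $4$-point permutations is not quasirandom-forcing.
   Context: Permutations are written in one-line notation $\pi(1)\pi(2)\cdots\pi(k)$. Pattern density $d(\sigma,\pi)$: probability that a uniformly random $|\sigma|$-subset of positions of $\pi$ induces the pattern $\sigma$. A set $S$ of permutations is quasirandom-forcing if every sequence of permutations with sizes tending to infinity and $d(\sigma,\pi_n)\to1/|\sigma|!$ for all $\sigma\in S$ has $d(\sigma,\pi_n)\to1/|\sigma|!$ for all permutations $\sigma$. -}

module Defs where

open import Data.Nat using (ℕ; zero; suc; _≤_; _<?_)
open import Data.Nat.Combinatorics using (_C_)
open import Data.Nat.Base using (_!)
open import Data.Fin using (Fin; zero; suc)
open import Data.Fin.Properties using () renaming (_<?_ to _<ᶠ?_)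
open import Data.Fin.Permutation using (Permutation′; permutation; _⟨$⟩ʳ_)
open import Data.Integer using (+_)
open import Data.Rational using (ℚ; 0ℚ; _/_; ∣_∣; _-_; _<_)
open import Data.List using (List; []; _∷_; _++_; map; length; filter; foldr; allFin)
open import Data.Bool using (Bool; true; false; _∧_; if_then_else_)
open import Data.Bool using () renaming (_≟_ to _≟ᵇ_)
open import Data.Product using (Σ; ∃; _,_; proj₁; proj₂)
open import Data.List.Membership.Propositional using (_∈_)
open import Relation.Nullary using (does)
open import Relation.Binary.PropositionalEquality using (_≡_; refl)

Perm : ℕ → Set
Perm = Permutation′

-- All strictly increasing maps Fin k → Fin n, i.e. all k-subsets of
-- positions {0,…,n-1}, each listed exactly once.
choose : (k n : ℕ) → List (Fin k → Fin n)
choose zero    n       = (λ ()) ∷ []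
choose (suc k) zero    = []
choose (suc k) (suc n) =
  map (λ g → λ i → suc (g i)) (choose (suc k) n)
  ++ map (λ g → λ { zero → zero ; (suc i) → suc (g i) }) (choose k n)

allB : {A : Set} → (A → Bool) → List A → Bool
allB p = foldr (λ x r → p x ∧ r) true

induces : {k n : ℕ} → Perm k → Perm n → (Fin k → Fin n) → Bool
induces {k} σ π g =
  allB (λ a → allB (λ b →
        does ((σ ⟨$⟩ʳ a) <ᶠ? (σ ⟨$⟩ʳ b))
          ≟ᵇ′ does ((π ⟨$⟩ʳ (g a)) <ᶠ? (π ⟨$⟩ʳ (g b))))
      (allFin k)) (allFin k)
  where
  _≟ᵇ′_ : Bool → Bool → Bool
  true  ≟ᵇ′ true  = true
  false ≟ᵇ′ false = true
  _     ≟ᵇ′ _     = false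

occurrences : {k n : ℕ} → Perm k → Perm n → ℕ
occurrences {k} {n} σ π = length (filter (λ g → induces σ π g ≟ᵇ true) (choose k n))

ratio : ℕ → ℕ → ℚ
ratio a zero    = 0ℚ
ratio a (suc d) = (+ a) / (suc d)

-- pattern density d(σ, π) = occurrences / (n choose k)
-- (convention: 0 when n < k; irrelevant as sizes tend to infinity)
density : {k n : ℕ} → Perm k → Perm n → ℚ
density {k} {n} σ π = ratio (occurrences σ π) (n C k)

_⟶_ : (ℕ → ℚ) → ℚ → Set
a ⟶ c = (ε : ℚ) → 0ℚ < ε → ∃ λ N → (m : ℕ) → N ≤ m → ∣ a m - c ∣ < ε

TendsToInfinity : (ℕ → ℕ) → Set
TendsToInfinity s = (M : ℕ) → ∃ λ N → (m : ℕ) → N ≤ m → M ≤ s m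

QuasirandomForcing : List (Σ ℕ Perm) → Set
QuasirandomForcing S =
  (size : ℕ → ℕ) (π : (m : ℕ) → Perm (size m)) →
  TendsToInfinity size →
  ((σ : Σ ℕ Perm) → σ ∈ S → (λ m → density (proj₂ σ) (π m)) ⟶ ratio 1 (proj₁ σ !)) →
  (k : ℕ) (σ : Perm k) → (λ m → density σ (π m)) ⟶ ratio 1 (k !)

involution : {n : ℕ} (f : Fin n → Fin n) → (∀ i → f (f i) ≡ i) → Perm n
involution f inv = permutation f f inv inv

p1234 p2143 p3412 p4321 : Perm 4
p1234 = involution (λ i → i) (λ i → refl)
p2143 = involution f inv
  where
  f : Fin 4 → Fin 4
  f zero = suc zero ; f (suc zero) = zero
  f (suc (suc zero)) = suc (suc (suc zero)) ; f (suc (suc (suc zero))) = suc (suc zero)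
  inv : ∀ i → f (f i) ≡ i
  inv zero = refl ; inv (suc zero) = refl
  inv (suc (suc zero)) = refl ; inv (suc (suc (suc zero))) = refl
p3412 = involution f inv
  where
  f : Fin 4 → Fin 4
  f zero = suc (suc zero) ; f (suc zero) = suc (suc (suc zero))
  f (suc (suc zero)) = zero ; f (suc (suc (suc zero))) = suc zero
  inv : ∀ i → f (f i) ≡ i
  inv zero = refl ; inv (suc zero) = refl
  inv (suc (suc zero)) = refl ; inv (suc (suc (suc zero))) = refl
p4321 = involution f inv
  where
  f : Fin 4 → Fin 4
  f zero = suc (suc (suc zero)) ; f (suc zero) = suc (suc zero)
  f (suc (suc zero)) = suc zero ; f (suc (suc (suc zero))) = zero
  inv : ∀ i → f (f i) ≡ i
  inv zero = refl ; inv (suc zero) = refl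
  inv (suc (suc zero)) = refl ; inv (suc (suc (suc zero))) = refl

S-cross : List (Σ ℕ Perm)
S-cross = (4 , p1234) ∷ (4 , p2143) ∷ (4 , p3412) ∷ (4 , p4321) ∷ []

{-# OPTIONS --safe #-}

-- Replace every point of a permutation τ of size K by a monotone run of m
-- consecutive points, increasing or decreasing according to a sign attached to the
-- point.  As m → ∞ the density of a pattern of size k in this inflation tends to
-- W / Kᵏ, where the integer W counts the occurrences that may use a block
-- several times, with multinomial weights.  For a suitable signed permutation of
-- size 48 the weights of 1234, 2143, 3412 and 4321 are all exactly 48⁴ / 24, whereas
-- the weight of 123 is 18480 ≠ 48³ / 6.

module Submission where

open import Defs
open import Relation.Nullary using (¬_)
open import Data.Bool using (Bool; true; false; if_then_else_; not; _xor_) renaming (_≟_ to _≟ᵇ_)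
open import Data.Fin using (Fin; zero; suc; toℕ; combine; remQuot; quotient; opposite; _↑ˡ_; _↑ʳ_) renaming (_<_ to _<ᶠ_)
open import Data.Fin.Permutation using (permutation; _⟨$⟩ʳ_; _⟨$⟩ˡ_; inverseˡ; inverseʳ)
open import Data.Fin.Properties using (all?; toℕ-injective; toℕ<n; toℕ-combine; combine-monoˡ-<; remQuot-combine; combine-surjective; opposite-prop; opposite-involutive; splitAt-↑ʳ) renaming (_<?_ to _<ᶠ?_; _≟_ to _≟ᶠ_; <-cmp to <ᶠ-cmp)
open import Data.Integer as ℤ using (+_; -[1+_])
import Data.Integer.Properties as ℤₚ
open import Data.List as List using (List; []; _∷_; _++_; map; length; filter; replicate; concatMap; allFin)
open import Data.List.Properties using (map-++; map-∘; map-cong-local; tabulate-cong)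
open import Data.List.Relation.Unary.All as All using (All; []; _∷_)
import Data.List.Relation.Unary.All.Properties as All
open import Data.List.Relation.Unary.Any using (here; there)
open import Data.Nat using (ℕ; zero; suc; _+_; _*_; _^_; _∸_; _≤_; _<_; z≤n; s≤s; s≤s⁻¹; >-nonZero; ≢-nonZero⁻¹; _≡ᵇ_; _<ᵇ_; _!) renaming (_≟_ to _≟ⁿ_)
open import Data.Nat.Combinatorics using (_C_; nCk+nC[k+1]≡[n+1]C[k+1]; nC1≡n)
open import Data.Nat.Coprimality using (Coprime)
open import Data.Nat.DivMod using (_mod_)
open import Data.Nat.ListAction using (sum)
open import Data.Nat.ListAction.Properties using (sum-++)
open import Data.Nat.Properties hiding (_≟_)
open import Data.Nat.Solver using (module +-*-Solver)
open import Data.List.Membership.Propositional using (_∈_)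
open import Data.Product using (∃; Σ; _×_; _,_; proj₁; proj₂)
open import Data.Rational as ℚ using (ℚ; mkℚ; 0ℚ)
import Data.Rational.Properties as ℚₚ
open import Algebra.Properties.AbelianGroup ℚₚ.+-0-abelianGroup using (⁻¹-anti-homo‿-; x∙y⁻¹≈ε⇒x≈y)
open import Data.Rational.Unnormalised as ℚᵘ using (mkℚᵘ; *<*)
import Data.Rational.Unnormalised.Properties as ℚᵘₚ
open import Data.Sum using (inj₁; inj₂)
open import Data.Vec as Vec using (Vec; []; _∷_; lookup)
open import Data.Vec.Properties using (lookup∘tabulate)
open import Function using (_∘_; _⇔_; mk⇔)
open import Relation.Binary.Definitions using (tri<; tri≈; tri>)
open import Relation.Binary.PropositionalEquality
open import Relation.Nullary using (does; yes; no; contradiction)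
open import Relation.Nullary.Decidable using (does-⇔; dec-true; dec-false; toWitness; toWitnessFalse)

-- Inside a monotone block the relative order of two points is decided by their positions alone.
-- Whether chosen points form a pattern therefore depends only on the sequence of blocks that
-- contain them, and `W` is a finite sum over multisets of blocks: 249900 of them for four points
-- and 48 blocks, few enough for evaluation by the type checker. No limit object is needed. With
-- `p = m - k`, the number of occurrences times `k !` lies between `p ^ k * W` and
-- `(p + k) ^ k * W`, and the number of position sets times `k !` lies between the same powers times
-- `K ^ k`. All estimates are thus inequalities between natural numbers, and rationals enter only in
-- the passage to the limit.

private
  variable
    A : Set
    k m n : ℕ

-- Subsequences of blown-up words

subwords : (k : ℕ) → List A → List (Vec A k)
subwords zero    xs       = [] ∷ []
subwords (suc k) []       = []
subwords (suc k) (x ∷ xs) = subwords (suc k) xs ++ map (x ∷_) (subwords k xs)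

Σsub : (k : ℕ) → List A → (Vec A k → ℕ) → ℕ
Σsub k xs J = sum (map J (subwords k xs))

Σsub-∷ : ∀ k (x : A) xs (J : Vec A (suc k) → ℕ) →
         Σsub (suc k) (x ∷ xs) J ≡ Σsub (suc k) xs J + Σsub k xs (J ∘ (x ∷_))
Σsub-∷ k x xs J = begin
  sum (map J (subwords (suc k) xs ++ map (x ∷_) (subwords k xs)))
    ≡⟨ cong sum (map-++ J (subwords (suc k) xs) _) ⟩
  sum (map J (subwords (suc k) xs) ++ map J (map (x ∷_) (subwords k xs)))
    ≡⟨ sum-++ (map J (subwords (suc k) xs)) _ ⟩
  Σsub (suc k) xs J + sum (map J (map (x ∷_) (subwords k xs)))
    ≡⟨ cong (λ l → Σsub (suc k) xs J + sum l) (sym (map-∘ (subwords k xs))) ⟩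
  Σsub (suc k) xs J + Σsub k xs (J ∘ (x ∷_)) ∎
  where open ≡-Reasoning

-- With j = 0 this is Σᵢ w i (k ∸ i) · G (k ∸ i) (J ∘ (cⁱ ++_)): the initial
-- run of the letter c has length i, and j counts the letters already read.
Σrun : (ℕ → ℕ → ℕ) → (∀ k → (Vec A k → ℕ) → ℕ) → A → (k j : ℕ) → (Vec A k → ℕ) → ℕ
Σrun w G c zero    j J = w j 0 * G 0 J
Σrun w G c (suc k) j J = w j (suc k) * G (suc k) J + Σrun w G c k (suc j) (J ∘ (c ∷_))

-- Pascal's rule in every coefficient. The start at `suc j` omits the empty run, whose coefficient
-- is 1 for `m` and `suc m` alike. On the right, the first sum comes from subwords that skip the
-- additional copy of `c`, the second from those that use it.
Σrun-pascal : ∀ m (G : ∀ k → (Vec A k → ℕ) → ℕ) c k j J →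
  Σrun (λ i _ → suc m C i) G c k (suc j) J ≡
  Σrun (λ i _ → m C i) G c k (suc j) J + Σrun (λ i _ → m C i) G c k j J
Σrun-pascal m G c zero j J = begin
  (suc m C suc j) * G 0 J             ≡⟨ cong (_* G 0 J) (sym (nCk+nC[k+1]≡[n+1]C[k+1] m j)) ⟩
  (m C j + m C suc j) * G 0 J         ≡⟨ cong (_* G 0 J) (+-comm (m C j) _) ⟩
  (m C suc j + m C j) * G 0 J         ≡⟨ *-distribʳ-+ (G 0 J) (m C suc j) _ ⟩
  (m C suc j) * G 0 J + (m C j) * G 0 J ∎
  where open ≡-Reasoning
Σrun-pascal m G c (suc k) j J
  rewrite Σrun-pascal m G c k (suc j) (J ∘ (c ∷_)) | sym (nCk+nC[k+1]≡[n+1]C[k+1] m j) =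
  solve 5 (λ a b g x y → (a :+ b) :* g :+ (x :+ y) := (b :* g :+ x) :+ (a :* g :+ y)) refl
    (m C j) (m C suc j) (G (suc k) J) (Σrun (λ i _ → m C i) G c k (suc (suc j)) (J ∘ (c ∷_)))
    (Σrun (λ i _ → m C i) G c k (suc j) (J ∘ (c ∷_)))
  where open +-*-Solver

Σrun-0C : ∀ (G : ∀ k → (Vec A k → ℕ) → ℕ) c k j J → Σrun (λ i _ → 0 C i) G c k (suc j) J ≡ 0
Σrun-0C G c zero    j J = refl
Σrun-0C G c (suc k) j J = Σrun-0C G c k (suc j) (J ∘ (c ∷_))

-- A subword splits into an initial part taken from the `m` copies of `c` and a subword of `ys`; an
-- initial part of length `i` can be taken in `m C i` ways.
Σsub-replicate : ∀ m (c : A) ys k J →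
  Σsub k (replicate m c ++ ys) J ≡ Σrun (λ i _ → m C i) (λ k → Σsub k ys) c k 0 J
Σsub-replicate zero c ys zero J = sym (+-identityʳ _)
Σsub-replicate zero c ys (suc k) J
  rewrite Σrun-0C (λ k → Σsub k ys) c k 0 (J ∘ (c ∷_)) = sym (trans (+-identityʳ _) (+-identityʳ _))
Σsub-replicate (suc m) c ys zero J = sym (+-identityʳ _)
Σsub-replicate (suc m) c ys (suc k) J
  rewrite Σsub-∷ k c (replicate m c ++ ys) J
        | Σsub-replicate m c ys (suc k) J
        | Σsub-replicate m c ys k (J ∘ (c ∷_))
        | Σrun-pascal m (λ k → Σsub k ys) c k 0 (J ∘ (c ∷_)) =
  +-assoc (1 * Σsub (suc k) ys J) _ _

-- The sum of multinomial(w) · J w over the words w of length k whose letters follow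
-- the order of cs, with repetitions allowed; i.e. k ! times the coefficient of mᵏ in Σsub k (concatMap (replicate m) cs) J.
Σmultiset : (k : ℕ) → List A → (Vec A k → ℕ) → ℕ
Σmultiset k []       J = end k J
  where
  end : ∀ k → (Vec _ k → ℕ) → ℕ
  end zero    J = J []
  end (suc k) J = 0
Σmultiset k (c ∷ cs) J = Σrun (λ j r → (j + r) C j) (λ k → Σmultiset k cs) c k 0 J

-- Falling factorials between powers

-- The absorption identity, read as the recursion of the falling factorial `j ! * (m C j)`. Deriving
-- it from Pascal's rule avoids the side condition `j ≤ m` and any division.
!*C-suc : ∀ m j → suc j ! * (suc m C suc j) ≡ suc m * (j ! * (m C j))
!*C-suc m zero = begin
  1 * (suc m C 1)  ≡⟨ *-identityˡ _ ⟩
  suc m C 1        ≡⟨ nC1≡n (suc m) ⟩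
  suc m            ≡⟨ sym (*-identityʳ _) ⟩
  suc m * 1        ∎
  where open ≡-Reasoning
!*C-suc zero (suc j) = trans (*-zeroʳ (suc (suc j) !)) (sym (trans (*-identityˡ _) (*-zeroʳ (suc j !))))
!*C-suc (suc m) (suc j) = begin
  suc (suc j) ! * (suc (suc m) C suc (suc j))
    ≡⟨ cong (suc (suc j) ! *_) (sym (nCk+nC[k+1]≡[n+1]C[k+1] (suc m) (suc j))) ⟩
  suc (suc j) ! * (x + y)
    ≡⟨ solve 4 (λ i f x y → (con 1 :+ i) :* f :* (x :+ y) :=
                 f :* x :+ (i :* (f :* x) :+ (con 1 :+ i) :* f :* y)) refl (suc j) (suc j !) x y ⟩
  suc j ! * x + (suc j * (suc j ! * x) + suc (suc j) ! * y)
    ≡⟨ cong₂ (λ u v → suc j ! * x + (suc j * u + v)) (!*C-suc m j) (!*C-suc m (suc j)) ⟩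
  suc j ! * x + (suc j * (suc m * (j ! * (m C j))) + suc m * (suc j ! * (m C suc j)))
    ≡⟨ cong (λ z → suc j ! * x + z) (solve 5 (λ i n f x y → i :* (n :* (f :* x)) :+ n :* (i :* f :* y) :=
                 n :* (i :* f :* (x :+ y))) refl (suc j) (suc m) (j !) (m C j) (m C suc j)) ⟩
  suc j ! * x + suc m * (suc j ! * (m C j + m C suc j))
    ≡⟨ cong (λ z → suc j ! * x + suc m * (suc j ! * z)) (nCk+nC[k+1]≡[n+1]C[k+1] m j) ⟩
  suc j ! * x + suc m * (suc j ! * x) ∎
  where
  open ≡-Reasoning
  open +-*-Solver
  x = suc m C suc j
  y = suc m C suc (suc j)

!*C≤^ : ∀ m j → j ! * (m C j) ≤ m ^ j
!*C≤^ m       zero    = ≤-refl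
!*C≤^ zero    (suc j) = ≤-reflexive (*-zeroʳ (suc j !))
!*C≤^ (suc m) (suc j) = begin
  suc j ! * (suc m C suc j) ≡⟨ !*C-suc m j ⟩
  suc m * (j ! * (m C j))   ≤⟨ *-monoʳ-≤ (suc m) (!*C≤^ m j) ⟩
  suc m * m ^ j             ≤⟨ *-monoʳ-≤ (suc m) (^-monoˡ-≤ j (n≤1+n m)) ⟩
  suc m * suc m ^ j         ∎
  where open ≤-Reasoning

-- The `j` factors from `m` down to `m - j + 1` all exceed `p`.
^≤!*C : ∀ p m j → p + j ≤ m → p ^ j ≤ j ! * (m C j)
^≤!*C p m       zero    _ = ≤-refl
^≤!*C p zero    (suc j) h with () ← ≤-trans (≤-reflexive (sym (+-suc p j))) h
^≤!*C p (suc m) (suc j) h = begin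
  p * p ^ j                 ≤⟨ *-mono-≤ (≤-trans (m≤m+n p (suc j)) h) (^≤!*C p m j h′) ⟩
  suc m * (j ! * (m C j))   ≡⟨ sym (!*C-suc m j) ⟩
  suc j ! * (suc m C suc j) ∎
  where
  open ≤-Reasoning
  h′ : p + j ≤ m
  h′ = s≤s⁻¹ (≤-trans (≤-reflexive (sym (+-suc p j))) h)

!*C*! : ∀ j r → (j + r) ! ≡ j ! * ((j + r) C j) * r !
!*C*! zero    r = sym (+-identityʳ _)
!*C*! (suc j) r = begin
  suc (j + r) * (j + r) !                     ≡⟨ cong (suc (j + r) *_) (!*C*! j r) ⟩
  suc (j + r) * (j ! * ((j + r) C j) * r !)   ≡⟨ sym (*-assoc (suc (j + r)) (j ! * ((j + r) C j)) (r !)) ⟩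
  suc (j + r) * (j ! * ((j + r) C j)) * r !   ≡⟨ cong (_* r !) (sym (!*C-suc (j + r) j)) ⟩
  suc j ! * ((suc j + r) C suc j) * r !       ∎
  where open ≡-Reasoning

-- Comparison of subword sums with multiset sums

module _ (G H : ∀ k → (Vec A k → ℕ) → ℕ) (c : A) (m : ℕ) where

  private
    regroup : ∀ j r g → (j + r) ! * ((m C j) * g) ≡ ((j + r) C j) * ((j ! * (m C j)) * (r ! * g))
    regroup j r g rewrite !*C*! j r =
      solve 5 (λ a b c d e → a :* b :* c :* (d :* e) := b :* ((a :* d) :* (c :* e))) refl
        (j !) ((j + r) C j) (r !) (m C j) g
      where open +-*-Solver

    regroup^ : ∀ p j r h → ((j + r) C j) * (p ^ j * (p ^ r * h)) ≡ p ^ (j + r) * (((j + r) C j) * h)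
    regroup^ p j r h rewrite ^-distribˡ-+-* p j r =
      solve 4 (λ b x y h → b :* (x :* (y :* h)) := x :* y :* (b :* h)) refl
        ((j + r) C j) (p ^ j) (p ^ r) h
      where open +-*-Solver

    G∙ H∙ : ∀ k j → (Vec A k → ℕ) → ℕ
    G∙ = Σrun (λ i _ → m C i) G c
    H∙ = Σrun (λ i r → (i + r) C i) H c

  -- The comparison holds term by term. `(j + r) !` splits into `(j + r) C j`, which is the
  -- multinomial factor of the `H` sum, times `j !` and `r !`; the latter two turn `m C j` and
  -- `G r J` into quantities already bounded by powers of `m`.
  Σrun-upper : (∀ r J → r ! * G r J ≤ m ^ r * H r J) → ∀ k j J →
    (j + k) ! * Σrun (λ i _ → m C i) G c k j J ≤ m ^ (j + k) * Σrun (λ i r → (i + r) C i) H c k j J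
  Σrun-upper G≤H = go
    where
    open ≤-Reasoning
    term : ∀ j r J → (j + r) ! * ((m C j) * G r J) ≤ m ^ (j + r) * (((j + r) C j) * H r J)
    term j r J = begin
      (j + r) ! * ((m C j) * G r J)                             ≡⟨ regroup j r (G r J) ⟩
      ((j + r) C j) * ((j ! * (m C j)) * (r ! * G r J))
        ≤⟨ *-monoʳ-≤ ((j + r) C j) (*-mono-≤ (!*C≤^ m j) (G≤H r J)) ⟩
      ((j + r) C j) * (m ^ j * (m ^ r * H r J))                 ≡⟨ regroup^ m j r (H r J) ⟩
      m ^ (j + r) * (((j + r) C j) * H r J)                     ∎
    go : ∀ k j J → (j + k) ! * G∙ k j J ≤ m ^ (j + k) * H∙ k j J
    go zero    j J = term j 0 J
    go (suc k) j J = begin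
      (j + suc k) ! * ((m C j) * G (suc k) J + G∙ k (suc j) J′)
        ≡⟨ *-distribˡ-+ ((j + suc k) !) ((m C j) * G (suc k) J) _ ⟩
      (j + suc k) ! * ((m C j) * G (suc k) J) + (j + suc k) ! * G∙ k (suc j) J′
        ≤⟨ +-mono-≤ (term j (suc k) J)
             (subst (λ n → n ! * G∙ k (suc j) J′ ≤ m ^ n * H∙ k (suc j) J′)
               (sym (+-suc j k)) (go k (suc j) J′)) ⟩
      m ^ (j + suc k) * (((j + suc k) C j) * H (suc k) J) + m ^ (j + suc k) * H∙ k (suc j) J′
        ≡⟨ sym (*-distribˡ-+ (m ^ (j + suc k)) (((j + suc k) C j) * H (suc k) J) _) ⟩
      m ^ (j + suc k) * (((j + suc k) C j) * H (suc k) J + H∙ k (suc j) J′) ∎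
      where J′ = J ∘ (c ∷_)

  Σrun-lower : ∀ p → (∀ r J → p + r ≤ m → p ^ r * H r J ≤ r ! * G r J) → ∀ k j J → p + (j + k) ≤ m →
    p ^ (j + k) * Σrun (λ i r → (i + r) C i) H c k j J ≤ (j + k) ! * Σrun (λ i _ → m C i) G c k j J
  Σrun-lower p H≤G = go
    where
    open ≤-Reasoning
    term : ∀ j r J → p + (j + r) ≤ m →
           p ^ (j + r) * (((j + r) C j) * H r J) ≤ (j + r) ! * ((m C j) * G r J)
    term j r J h = begin
      p ^ (j + r) * (((j + r) C j) * H r J)                     ≡⟨ sym (regroup^ p j r (H r J)) ⟩
      ((j + r) C j) * (p ^ j * (p ^ r * H r J))
        ≤⟨ *-monoʳ-≤ ((j + r) C j) (*-mono-≤
             (^≤!*C p m j (≤-trans (+-monoʳ-≤ p (m≤m+n j r)) h))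
             (H≤G r J (≤-trans (+-monoʳ-≤ p (m≤n+m r j)) h))) ⟩
      ((j + r) C j) * ((j ! * (m C j)) * (r ! * G r J))         ≡⟨ sym (regroup j r (G r J)) ⟩
      (j + r) ! * ((m C j) * G r J)                             ∎
    go : ∀ k j J → p + (j + k) ≤ m → p ^ (j + k) * H∙ k j J ≤ (j + k) ! * G∙ k j J
    go zero    j J h = term j 0 J h
    go (suc k) j J h = begin
      p ^ (j + suc k) * (((j + suc k) C j) * H (suc k) J + H∙ k (suc j) J′)
        ≡⟨ *-distribˡ-+ (p ^ (j + suc k)) (((j + suc k) C j) * H (suc k) J) _ ⟩
      p ^ (j + suc k) * (((j + suc k) C j) * H (suc k) J) + p ^ (j + suc k) * H∙ k (suc j) J′
        ≤⟨ +-mono-≤ (term j (suc k) J h)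
             (subst (λ n → p ^ n * H∙ k (suc j) J′ ≤ n ! * G∙ k (suc j) J′)
               (sym (+-suc j k)) (go k (suc j) J′ (subst (λ n → p + n ≤ m) (+-suc j k) h))) ⟩
      (j + suc k) ! * ((m C j) * G (suc k) J) + (j + suc k) ! * G∙ k (suc j) J′
        ≡⟨ sym (*-distribˡ-+ ((j + suc k) !) ((m C j) * G (suc k) J) _) ⟩
      (j + suc k) ! * ((m C j) * G (suc k) J + G∙ k (suc j) J′) ∎
      where J′ = J ∘ (c ∷_)

Σsub-upper : ∀ m (cs : List A) k J →
  k ! * Σsub k (concatMap (replicate m) cs) J ≤ m ^ k * Σmultiset k cs J
Σsub-upper m []       zero    J = ≤-reflexive (cong (_+ 0) (+-identityʳ (J [])))
Σsub-upper m []       (suc k) J = ≤-reflexive (trans (*-zeroʳ (suc k !)) (sym (*-zeroʳ (m ^ suc k))))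
Σsub-upper m (c ∷ cs) k J
  rewrite Σsub-replicate m c (concatMap (replicate m) cs) k J =
  Σrun-upper (λ k → Σsub k (concatMap (replicate m) cs)) (λ k → Σmultiset k cs) c m (Σsub-upper m cs) k 0 J

Σsub-lower : ∀ p m (cs : List A) k J → p + k ≤ m →
  p ^ k * Σmultiset k cs J ≤ k ! * Σsub k (concatMap (replicate m) cs) J
Σsub-lower p m []       zero    J h = ≤-reflexive (sym (cong (_+ 0) (+-identityʳ (J []))))
Σsub-lower p m []       (suc k) J h = ≤-reflexive (trans (*-zeroʳ (p ^ suc k)) (sym (*-zeroʳ (suc k !))))
Σsub-lower p m (c ∷ cs) k J h
  rewrite Σsub-replicate m c (concatMap (replicate m) cs) k J =
  Σrun-lower (λ k → Σsub k (concatMap (replicate m) cs)) (λ k → Σmultiset k cs) c m p (Σsub-lower p m cs) k 0 J h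

-- Limits of ratios

-- The inequality is checked on unnormalised representatives, where the order is
-- cross-multiplication. The last summand is a raw `mkℚ` because ε arrives in that form by pattern
-- matching.
ratio-<-+ : ∀ a b c d e f .(co : Coprime e (suc f)) → a * (suc d * suc f) < (c * suc f + e * suc d) * suc b →
            ratio a (suc b) ℚ.< ratio c (suc d) ℚ.+ mkℚ (+ e) f co
ratio-<-+ a b c d e f co h = ℚₚ.toℚᵘ-cancel-< (ℚᵘₚ.<-respˡ-≃ (ℚᵘₚ.≃-sym (ℚₚ.toℚᵘ-fromℚᵘ (mkℚᵘ (+ a) b)))
  (ℚᵘₚ.<-respʳ-≃ (ℚᵘₚ.≃-sym rhs) (*<* (subst₂ ℤ._<_
    (ℤₚ.pos-* a (suc d * suc f)) eq (ℤ.+<+ h)))))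
  where
  rhs : ℚ.toℚᵘ (ratio c (suc d) ℚ.+ mkℚ (+ e) f co) ℚᵘ.≃ mkℚᵘ (+ c) d ℚᵘ.+ mkℚᵘ (+ e) f
  rhs = ℚᵘₚ.≃-trans (ℚₚ.toℚᵘ-homo-+ (ratio c (suc d)) (mkℚ (+ e) f co))
          (ℚᵘₚ.+-congˡ (mkℚᵘ (+ e) f) (ℚₚ.toℚᵘ-fromℚᵘ (mkℚᵘ (+ c) d)))
  eq : + ((c * suc f + e * suc d) * suc b) ≡ (+ c ℤ.* + suc f ℤ.+ + e ℤ.* + suc d) ℤ.* + suc b
  eq = trans (ℤₚ.pos-* (c * suc f + e * suc d) (suc b))
         (cong (ℤ._* + suc b) (trans (ℤₚ.pos-+ (c * suc f) (e * suc d))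
           (cong₂ ℤ._+_ (ℤₚ.pos-* c (suc f)) (ℤₚ.pos-* e (suc d)))))

p<q+r⇒p-q<r : ∀ p q {r} → p ℚ.< q ℚ.+ r → p ℚ.- q ℚ.< r
p<q+r⇒p-q<r p q {r} h = subst (p ℚ.- q ℚ.<_) (begin
  (q ℚ.+ r) ℚ.- q       ≡⟨ cong (ℚ._- q) (ℚₚ.+-comm q r) ⟩
  (r ℚ.+ q) ℚ.- q       ≡⟨ ℚₚ.+-assoc r q (ℚ.- q) ⟩
  r ℚ.+ (q ℚ.- q)       ≡⟨ cong (r ℚ.+_) (ℚₚ.+-inverseʳ q) ⟩
  r ℚ.+ 0ℚ              ≡⟨ ℚₚ.+-identityʳ r ⟩
  r                     ∎) (ℚₚ.+-monoˡ-< (ℚ.- q) h)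
  where open ≡-Reasoning

∣p-q∣<r : ∀ {p q r} → p ℚ.< q ℚ.+ r → q ℚ.< p ℚ.+ r → ℚ.∣ p ℚ.- q ∣ ℚ.< r
∣p-q∣<r {p} {q} {r} p< q< with ℚₚ.∣p∣≡p∨∣p∣≡-p (p ℚ.- q)
... | inj₁ eq = subst (ℚ._< r) (sym eq) (p<q+r⇒p-q<r p q p<)
... | inj₂ eq = subst (ℚ._< r) (sym (trans eq (⁻¹-anti-homo‿- p q))) (p<q+r⇒p-q<r q p q<)

⟶-unique : ∀ a {x y} → a ⟶ x → a ⟶ y → x ≡ y
⟶-unique a {x} {y} a⟶x a⟶y with x ℚₚ.≟ y
... | yes x≡y = x≡y
... | no x≢y = contradiction δ<δ (ℚₚ.<-irrefl refl)
  where
  δ ε : ℚ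
  δ = ℚ.∣ x ℚ.- y ∣
  ε = ℚ.½ ℚ.* δ
  0<δ : 0ℚ ℚ.< δ
  0<δ = ℚₚ.≰⇒> λ δ≤0 → x≢y (x∙y⁻¹≈ε⇒x≈y x y (ℚₚ.∣p∣≡0⇒p≡0 (x ℚ.- y) (ℚₚ.≤-antisym δ≤0 (ℚₚ.0≤∣p∣ (x ℚ.- y)))))
  0<ε : 0ℚ ℚ.< ε
  0<ε = subst (ℚ._< ε) (ℚₚ.*-zeroʳ ℚ.½) (ℚₚ.*-monoʳ-<-pos ℚ.½ 0<δ)
  ε+ε≡δ : ε ℚ.+ ε ≡ δ
  ε+ε≡δ = trans (sym (ℚₚ.*-distribʳ-+ δ ℚ.½ ℚ.½)) (ℚₚ.*-identityˡ δ)
  N₁ N₂ N₃ : ℕ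
  N₁ = proj₁ (a⟶x ε 0<ε)
  N₂ = proj₁ (a⟶y ε 0<ε)
  N₃  = N₁ + N₂
  split : (x ℚ.- a N₃) ℚ.+ (a N₃ ℚ.- y) ≡ x ℚ.- y
  split = begin
    (x ℚ.- a N₃) ℚ.+ (a N₃ ℚ.- y)         ≡⟨ ℚₚ.+-assoc x (ℚ.- a N₃) (a N₃ ℚ.- y) ⟩
    x ℚ.+ (ℚ.- a N₃ ℚ.+ (a N₃ ℚ.- y))     ≡⟨ cong (x ℚ.+_) (sym (ℚₚ.+-assoc (ℚ.- a N₃) (a N₃) (ℚ.- y))) ⟩
    x ℚ.+ ((ℚ.- a N₃ ℚ.+ a N₃) ℚ.- y)     ≡⟨ cong (λ z → x ℚ.+ (z ℚ.- y)) (ℚₚ.+-inverseˡ (a N₃)) ⟩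
    x ℚ.+ (0ℚ ℚ.- y)                    ≡⟨ cong (x ℚ.+_) (ℚₚ.+-identityˡ (ℚ.- y)) ⟩
    x ℚ.- y                             ∎
    where open ≡-Reasoning
  x-near : ℚ.∣ x ℚ.- a N₃ ∣ ℚ.< ε
  x-near = subst (ℚ._< ε)
    (trans (sym (ℚₚ.∣-p∣≡∣p∣ (a N₃ ℚ.- x))) (cong ℚ.∣_∣ (⁻¹-anti-homo‿- (a N₃) x)))
    (proj₂ (a⟶x ε 0<ε) N₃ (m≤m+n N₁ N₂))
  δ<δ : δ ℚ.< δ
  δ<δ = begin-strict
    δ                                           ≡⟨ cong ℚ.∣_∣ (sym split) ⟩
    ℚ.∣ (x ℚ.- a N₃) ℚ.+ (a N₃ ℚ.- y) ∣           ≤⟨ ℚₚ.∣p+q∣≤∣p∣+∣q∣ (x ℚ.- a N₃) (a N₃ ℚ.- y) ⟩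
    ℚ.∣ x ℚ.- a N₃ ∣ ℚ.+ ℚ.∣ a N₃ ℚ.- y ∣         <⟨ ℚₚ.+-mono-< x-near (proj₂ (a⟶y ε 0<ε) N₃ (m≤n+m N₂ N₁)) ⟩
    ε ℚ.+ ε                                     ≡⟨ ε+ε≡δ ⟩
    δ                                           ∎
    where open ℚₚ.≤-Reasoning

-- For `p` beyond `E`, the error `E * n` is smaller than `p * n`, so division by `p` leaves an error
-- below `n`. The factor `suc d` will be the numerator of ε.
*-cancel-bound : ∀ p s t n d E → 0 < n → E < p → p * s ≤ p * t + E * n → s < t + suc d * n
*-cancel-bound p s t n d E 0<n E<p h = *-cancelˡ-< p s (t + suc d * n) (begin-strict
  p * s                 ≤⟨ h ⟩
  p * t + E * n         <⟨ +-monoʳ-< (p * t) (*-monoˡ-< n ⦃ >-nonZero 0<n ⦄ E<p) ⟩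
  p * t + p * n         ≤⟨ +-monoʳ-≤ (p * t) (*-monoʳ-≤ p (m≤m+n n (d * n))) ⟩
  p * t + p * (suc d * n) ≡⟨ sym (*-distribˡ-+ p t (suc d * n)) ⟩
  p * (t + suc d * n)   ∎)
  where open ≤-Reasoning

-- The two inequalities are cross-multiplied: at index `p + k` the ratio is the limit times a factor
-- between `p / (p + c)` and `(p + c) / p`.
ratio-⟶ : ∀ (a n : ℕ → ℕ) w d c k →
  (∀ p → 0 < p → 0 < n (p + k)) →
  (∀ p → 0 < p → a (p + k) * suc d * p ≤ w * (p + c) * n (p + k)) →
  (∀ p → 0 < p → w * p * n (p + k) ≤ a (p + k) * suc d * (p + c)) →
  (λ m → ratio (a m) (n m)) ⟶ ratio w (suc d)
ratio-⟶ a n w d c k n>0 upper lower (mkℚ (+ zero)  f co) (ℚ.*<* (ℤ.+<+ ()))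
ratio-⟶ a n w d c k n>0 upper lower (mkℚ -[1+ e ] f co) (ℚ.*<* ())
ratio-⟶ a n w d c k n>0 upper lower (mkℚ (+ suc e) f co) _ = suc E + k , close
  where
  -- Dominates both errors after scaling by the denominator `suc f` of ε: `w * c * y` in the upper
  -- estimate, and `x * suc d * c` in the lower one, where `x * suc d` is at most `w * suc c * y`.
  E = w * suc c * c * suc f
  near : ∀ x y p → 0 < p → 0 < y → E < p → x * suc d * p ≤ w * (p + c) * y →
         w * p * y ≤ x * suc d * (p + c) → ℚ.∣ ratio x y ℚ.- ratio w (suc d) ∣ ℚ.< mkℚ (+ suc e) f co
  near x (suc y) p 0<p _ E<p up lo = ∣p-q∣<r
    (ratio-<-+ x y w d (suc e) f co (subst₂ _<_ (*-assoc x D F)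
      (solve 5 (λ w y f e d → w :* y :* f :+ e :* (y :* d) := (w :* f :+ e :* d) :* y) refl w Y F (suc e) D)
      (*-cancel-bound p (x * D * F) (w * Y * F) (Y * D) e E (s≤s z≤n) E<p above)))
    (ratio-<-+ w d x y (suc e) f co (subst₂ _<_ (*-assoc w Y F)
      (solve 5 (λ x d f e y → x :* d :* f :+ e :* (y :* d) := (x :* f :+ e :* y) :* d) refl x D F (suc e) Y)
      (*-cancel-bound p (w * Y * F) (x * D * F) (Y * D) e E (s≤s z≤n) E<p below)))
    where
    open +-*-Solver
    open ≤-Reasoning
    D Y F : ℕ
    D = suc d
    Y = suc y
    F = suc f
    instance
      _ = >-nonZero 0<p
    above : p * (x * D * F) ≤ p * (w * Y * F) + E * (Y * D)
    above = begin
      p * (x * D * F)                   ≡⟨ solve 3 (λ p x f → p :* (x :* f) := x :* p :* f) refl p (x * D) F ⟩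
      x * D * p * F                     ≤⟨ *-monoˡ-≤ F up ⟩
      w * (p + c) * Y * F               ≡⟨ solve 5 (λ w p c y f → w :* (p :+ c) :* y :* f :=
                                             p :* (w :* y :* f) :+ w :* con 1 :* c :* f :* (y :* con 1)) refl w p c Y F ⟩
      p * (w * Y * F) + w * 1 * c * F * (Y * 1)
        ≤⟨ +-monoʳ-≤ (p * (w * Y * F)) (*-mono-≤
             (*-monoˡ-≤ F (*-monoˡ-≤ c (*-monoʳ-≤ w (s≤s z≤n)))) (*-monoʳ-≤ Y (s≤s z≤n))) ⟩
      p * (w * Y * F) + E * (Y * D)     ∎
    -- A crude consequence of the upper estimate, from `c ≤ c * p`. It removes `x` from the error of
    -- the lower estimate.
    xD≤ : x * D ≤ w * suc c * Y
    xD≤ = *-cancelʳ-≤ (x * D) (w * suc c * Y) p (begin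
      x * D * p               ≤⟨ up ⟩
      w * (p + c) * Y         ≤⟨ *-monoˡ-≤ Y (*-monoʳ-≤ w (+-monoʳ-≤ p (m≤m*n c p))) ⟩
      w * (p + c * p) * Y     ≡⟨ solve 4 (λ w p c y → w :* (p :+ c :* p) :* y :=
                                   w :* (con 1 :+ c) :* y :* p) refl w p c Y ⟩
      w * suc c * Y * p       ∎)
    below : p * (w * Y * F) ≤ p * (x * D * F) + E * (Y * D)
    below = begin
      p * (w * Y * F)                         ≡⟨ solve 4 (λ p w y f → p :* (w :* y :* f) := w :* p :* y :* f) refl p w Y F ⟩
      w * p * Y * F                           ≤⟨ *-monoˡ-≤ F lo ⟩
      x * D * (p + c) * F                     ≡⟨ solve 4 (λ x p c f → x :* (p :+ c) :* f :=
                                                   p :* (x :* f) :+ x :* (c :* f)) refl (x * D) p c F ⟩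
      p * (x * D * F) + x * D * (c * F)       ≤⟨ +-monoʳ-≤ (p * (x * D * F)) (*-monoˡ-≤ (c * F) xD≤) ⟩
      p * (x * D * F) + w * suc c * Y * (c * F)
        ≡⟨ cong (λ z → p * (x * D * F) + z) (solve 4 (λ v y c f → v :* y :* (c :* f) :=
             v :* c :* f :* (y :* con 1)) refl (w * suc c) Y c F) ⟩
      p * (x * D * F) + E * (Y * 1)           ≤⟨ +-monoʳ-≤ (p * (x * D * F)) (*-monoʳ-≤ E (*-monoʳ-≤ Y (s≤s z≤n))) ⟩
      p * (x * D * F) + E * (Y * D)           ∎
  close : ∀ m → suc E + k ≤ m → ℚ.∣ ratio (a m) (n m) ℚ.- ratio w (suc d) ∣ ℚ.< mkℚ (+ suc e) f co
  close m h = subst (λ m → ℚ.∣ ratio (a m) (n m) ℚ.- ratio w (suc d) ∣ ℚ.< mkℚ (+ suc e) f co)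
    (m∸n+n≡m (≤-trans (m≤n+m k (suc E)) h))
    (near _ _ p 0<p (n>0 p 0<p) E<p (upper p 0<p) (lower p 0<p))
    where
    p = m ∸ k
    E<p : E < p
    E<p = ≤-trans (≤-reflexive (sym (m+n∸n≡m (suc E) k))) (∸-monoˡ-≤ k h)
    0<p : 0 < p
    0<p = ≤-trans (s≤s z≤n) E<p

-- Inflations by monotone blocks

Increasing : (Fin k → Fin n) → Set
Increasing g = ∀ a b → a <ᶠ b → g a <ᶠ g b

choose-increasing : ∀ k n → All Increasing (choose k n)
choose-increasing zero    n       = (λ ()) ∷ []
choose-increasing (suc k) zero    = []
choose-increasing (suc k) (suc n) = All.++⁺
  (All.map⁺ (All.map (λ inc a b a<b → s≤s (inc a b a<b)) (choose-increasing (suc k) n)))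
  (All.map⁺ (All.map (λ inc → λ { zero    (suc b) _         → s≤s z≤n
                                ; (suc a) (suc b) (s≤s a<b) → s≤s (inc a b a<b) })
              (choose-increasing k n)))

does-increasing : ∀ {g : Fin k → Fin n} → Increasing g → ∀ a b → does (g a <ᶠ? g b) ≡ does (a <ᶠ? b)
does-increasing {g = g} inc a b = does-⇔ (mk⇔ reflect (inc a b)) (g a <ᶠ? g b) (a <ᶠ? b)
  where
  reflect : g a <ᶠ g b → a <ᶠ b
  reflect ga<gb with <ᶠ-cmp a b
  ... | tri< a<b _ _ = a<b
  ... | tri≈ _ refl _ = contradiction ga<gb (<-irrefl refl)
  ... | tri> _ _ b<a = contradiction (inc b a b<a) (<-asym ga<gb)

-- `choose` and `subwords` both list the selections that skip the head before those that use it, so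
-- the two lists agree entry by entry.
map-choose : ∀ {A : Set} k n (q : Fin n → A) →
  map (λ g → Vec.tabulate (q ∘ g)) (choose k n) ≡ subwords k (List.tabulate q)
map-choose zero    n       q = refl
map-choose (suc k) zero    q = refl
map-choose (suc k) (suc n) q = trans (map-++ _ (map _ (choose (suc k) n)) _) (cong₂ _++_
  (trans (sym (map-∘ (choose (suc k) n))) (map-choose (suc k) n (q ∘ suc)))
  -- The fused map is split again in another way: tabulating along a selection that uses position
  -- `zero` computes to `q zero` followed by the tabulation of the rest.
  (trans (sym (map-∘ (choose k n))) (trans (map-∘ (choose k n)) (cong (map (q zero ∷_)) (map-choose k n (q ∘ suc))))))

indicator : Bool → ℕ
indicator b = if b then 1 else 0

length-filter : ∀ {A : Set} (p : A → Bool) xs →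
  length (filter (λ x → p x ≟ᵇ true) xs) ≡ sum (map (indicator ∘ p) xs)
length-filter p [] = refl
length-filter p (x ∷ xs) with p x
... | true  = cong suc (length-filter p xs)
... | false = length-filter p xs

allB-cong : ∀ {A : Set} {p q : A → Bool} → (∀ x → p x ≡ q x) → ∀ xs → allB p xs ≡ allB q xs
allB-cong p≗q []       = refl
allB-cong p≗q (x ∷ xs) rewrite p≗q x | allB-cong p≗q xs = refl

-- The Boolean equivalence inside induces is local to its definition and
-- cannot be named here; unification recovers it.
agreement : ∀ {k n} (σ : Perm k) (π : Perm n) (g : Fin k → Fin n) →
  ∃ λ (p : Fin k → Fin k → Bool) → induces σ π g ≡ allB (λ a → allB (p a) (allFin k)) (allFin k)
agreement σ π g = _ , refl

induces-cong : (σ : Perm k) (π : Perm n) (g : Fin k → Fin n) (R : Fin k → Fin k → Bool) →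
  (∀ a b → does ((π ⟨$⟩ʳ g a) <ᶠ? (π ⟨$⟩ʳ g b)) ≡ R a b) →
  induces σ π g ≡
    allB (λ a → allB (λ b → not (does ((σ ⟨$⟩ʳ a) <ᶠ? (σ ⟨$⟩ʳ b)) xor R a b)) (allFin k)) (allFin k)
induces-cong {k} σ π g R h = allB-cong (λ a → allB-cong (agree a) (allFin k)) (allFin k)
  where
  xnor : ∀ a b → proj₁ (agreement σ π g) a b ≡
    not (does ((σ ⟨$⟩ʳ a) <ᶠ? (σ ⟨$⟩ʳ b)) xor does ((π ⟨$⟩ʳ g a) <ᶠ? (π ⟨$⟩ʳ g b)))
  xnor a b with does ((σ ⟨$⟩ʳ a) <ᶠ? (σ ⟨$⟩ʳ b)) | does ((π ⟨$⟩ʳ g a) <ᶠ? (π ⟨$⟩ʳ g b))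
  ... | true  | true  = refl
  ... | true  | false = refl
  ... | false | true  = refl
  ... | false | false = refl
  agree : ∀ a b → proj₁ (agreement σ π g) a b ≡ not (does ((σ ⟨$⟩ʳ a) <ᶠ? (σ ⟨$⟩ʳ b)) xor R a b)
  agree a b = trans (xnor a b) (cong (λ r → not (does ((σ ⟨$⟩ʳ a) <ᶠ? (σ ⟨$⟩ʳ b)) xor r)) (h a b))

Label : Set
Label = ℕ × Bool

-- Whether the entry at the first of two positions is the smaller one, given the
-- labels (value , increasing?) of their blocks and the order of the positions.
below : Label → Label → Bool → Bool → Bool
below (u , s) (v , _) l r = if u ≡ᵇ v then (if s then l else r) else (u <ᵇ v)

-- Reads only block labels and the order of letters in the word, so a single function on words
-- counts occurrences for every block length.
matches : Perm k → Vec Label k → Bool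
matches {k} σ w = allB (λ a → allB (λ b →
  not (does ((σ ⟨$⟩ʳ a) <ᶠ? (σ ⟨$⟩ʳ b)) xor
       below (lookup w a) (lookup w b) (does (a <ᶠ? b)) (does (b <ᶠ? a))))
  (allFin k)) (allFin k)

tabulate-++ : ∀ {A : Set} m n (f : Fin (m + n) → A) →
  List.tabulate f ≡ List.tabulate (f ∘ (_↑ˡ n)) ++ List.tabulate (f ∘ (m ↑ʳ_))
tabulate-++ zero    n f = refl
tabulate-++ (suc m) n f = cong (f zero ∷_) (tabulate-++ m n (f ∘ suc))

tabulate-const : ∀ {A : Set} m {f : Fin m → A} c → (∀ i → f i ≡ c) → List.tabulate f ≡ replicate m c
tabulate-const zero    c h = refl
tabulate-const (suc m) c h = cong₂ _∷_ (h zero) (tabulate-const m c (h ∘ suc))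

tabulate-quotient : ∀ {A : Set} K m (q : Fin K → A) →
  List.tabulate (λ x → q (quotient {K} m x)) ≡ concatMap (replicate m) (List.tabulate q)
tabulate-quotient zero    m q = refl
tabulate-quotient (suc K) m q = trans (tabulate-++ m (K * m) _) (cong₂ _++_
  (tabulate-const m (q zero) (λ i → cong (q ∘ proj₁) (remQuot-combine {suc K} zero i)))
  (trans (tabulate-cong λ y → cong q (quotient-↑ʳ y)) (tabulate-quotient K m (q ∘ suc))))
  where
  quotient-↑ʳ : ∀ y → quotient {suc K} m (m ↑ʳ y) ≡ suc (quotient {K} m y)
  quotient-↑ʳ y rewrite splitAt-↑ʳ m (K * m) y = refl

combine-<⇔ : ∀ {K m} (i : Fin K) (a b : Fin m) → (combine i a <ᶠ combine i b) ⇔ (a <ᶠ b)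
combine-<⇔ {m = m} i a b = mk⇔
  (λ h → +-cancelˡ-< (m * toℕ i) (toℕ a) (toℕ b) (subst₂ _<_ (toℕ-combine i a) (toℕ-combine i b) h))
  (λ h → subst₂ _<_ (sym (toℕ-combine i a)) (sym (toℕ-combine i b)) (+-monoʳ-< (m * toℕ i) h))

combine-<⇔-≢ : ∀ {K m} {i j : Fin K} (a b : Fin m) → i ≢ j → (combine i a <ᶠ combine j b) ⇔ (i <ᶠ j)
combine-<⇔-≢ {i = i} {j} a b i≢j = mk⇔ reflect (combine-monoˡ-< a b)
  where
  reflect : combine i a <ᶠ combine j b → i <ᶠ j
  reflect h with <ᶠ-cmp i j
  ... | tri< i<j _ _ = i<j
  ... | tri≈ _ i≡j _ = contradiction i≡j i≢j
  ... | tri> _ _ j<i = contradiction (combine-monoˡ-< b a j<i) (<-asym h)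

opposite-<⇔ : ∀ (a b : Fin m) → (opposite a <ᶠ opposite b) ⇔ (b <ᶠ a)
opposite-<⇔ {m} a b = mk⇔ (λ h → subst₂ _<ᶠ_ (opposite-involutive b) (opposite-involutive a) (anti (opposite a) (opposite b) h)) (anti b a)
  where
  anti : ∀ (a b : Fin m) → a <ᶠ b → opposite b <ᶠ opposite a
  anti a b a<b = subst₂ _<_ (sym (opposite-prop b)) (sym (opposite-prop a)) (∸-monoʳ-< (s≤s a<b) (toℕ<n b))

orient : Bool → Fin m → Fin m
orient s a = if s then a else opposite a

orient-involutive : ∀ s (a : Fin m) → orient s (orient s a) ≡ a
orient-involutive true  a = refl
orient-involutive false a = opposite-involutive a

module Inflation {K : ℕ} (τ : Perm K) (s : Fin K → Bool) where

  to : ∀ m → Fin (K * m) → Fin (K * m)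
  to m x = let i , a = remQuot {K} m x in combine (τ ⟨$⟩ʳ i) (orient (s i) a)

  -- `orient` is its own inverse, so the same sign undoes it; signs are attached to positions, hence
  -- the sign is looked up at `τ ⟨$⟩ˡ j`.
  from : ∀ m → Fin (K * m) → Fin (K * m)
  from m y = let j , b = remQuot {K} m y in combine (τ ⟨$⟩ˡ j) (orient (s (τ ⟨$⟩ˡ j)) b)

  to-combine : ∀ {m} i (a : Fin m) → to m (combine i a) ≡ combine (τ ⟨$⟩ʳ i) (orient (s i) a)
  to-combine i a = cong (λ (i , a) → combine (τ ⟨$⟩ʳ i) (orient (s i) a)) (remQuot-combine i a)

  from-combine : ∀ {m} j (b : Fin m) → from m (combine j b) ≡ combine (τ ⟨$⟩ˡ j) (orient (s (τ ⟨$⟩ˡ j)) b)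
  from-combine j b = cong (λ (j , b) → combine (τ ⟨$⟩ˡ j) (orient (s (τ ⟨$⟩ˡ j)) b)) (remQuot-combine j b)

  to-from : ∀ m y → to m (from m y) ≡ y
  to-from m y with combine-surjective {K} {m} y
  ... | j , b , refl = begin
    to m (from m (combine j b))                             ≡⟨ cong (to m) (from-combine j b) ⟩
    to m (combine i (orient (s i) b))                       ≡⟨ to-combine i (orient (s i) b) ⟩
    combine (τ ⟨$⟩ʳ i) (orient (s i) (orient (s i) b))      ≡⟨ cong₂ combine (inverseʳ τ) (orient-involutive (s i) b) ⟩
    combine j b                                             ∎
    where
    open ≡-Reasoning
    i = τ ⟨$⟩ˡ j

  from-to : ∀ m x → from m (to m x) ≡ x
  from-to m x with combine-surjective {K} {m} x
  ... | i , a , refl = begin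
    from m (to m (combine i a))                             ≡⟨ cong (from m) (to-combine i a) ⟩
    from m (combine (τ ⟨$⟩ʳ i) (orient (s i) a))            ≡⟨ from-combine (τ ⟨$⟩ʳ i) (orient (s i) a) ⟩
    combine (τ ⟨$⟩ˡ (τ ⟨$⟩ʳ i)) (orient (s (τ ⟨$⟩ˡ (τ ⟨$⟩ʳ i))) (orient (s i) a))
      ≡⟨ cong (λ j → combine j (orient (s j) (orient (s i) a))) (inverseˡ τ) ⟩
    combine i (orient (s i) (orient (s i) a))               ≡⟨ cong (combine i) (orient-involutive (s i) a) ⟩
    combine i a                                             ∎
    where open ≡-Reasoning

  inflate : ∀ m → Perm (K * m)
  inflate m = permutation (to m) (from m) (to-from m) (from-to m)

  label : Fin K → Label
  label i = toℕ (τ ⟨$⟩ʳ i) , s i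

  labels : List Label
  labels = List.tabulate label

  τ-injective : ∀ {i j} → τ ⟨$⟩ʳ i ≡ τ ⟨$⟩ʳ j → i ≡ j
  τ-injective eq = trans (sym (inverseˡ τ)) (trans (cong (τ ⟨$⟩ˡ_) eq) (inverseˡ τ))

  -- `combine` is lexicographic: distinct blocks compare as their values under `τ`, and within one
  -- block the order of positions is kept or reversed by the sign.
  does-to-combine : ∀ {m} i (a : Fin m) j b →
    does (to m (combine i a) <ᶠ? to m (combine j b)) ≡
    below (label i) (label j) (does (combine i a <ᶠ? combine j b)) (does (combine j b <ᶠ? combine i a))
  does-to-combine {m} i a j b with i ≟ᶠ j
  ... | yes refl
    -- The Boolean of `≟ⁿ` computes to the test `≡ᵇ` in `below`, so this rewrite selects the branch
    -- for equal blocks.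
    rewrite dec-true (toℕ (τ ⟨$⟩ʳ i) ≟ⁿ toℕ (τ ⟨$⟩ʳ i)) refl | to-combine i a | to-combine i b
    with s i
  ... | true  = trans
    (does-⇔ (combine-<⇔ (τ ⟨$⟩ʳ i) a b) (combine (τ ⟨$⟩ʳ i) a <ᶠ? combine (τ ⟨$⟩ʳ i) b) (a <ᶠ? b))
    (sym (does-⇔ (combine-<⇔ i a b) (combine i a <ᶠ? combine i b) (a <ᶠ? b)))
  ... | false = trans
    (does-⇔ (combine-<⇔ (τ ⟨$⟩ʳ i) (opposite a) (opposite b))
      (combine (τ ⟨$⟩ʳ i) (opposite a) <ᶠ? combine (τ ⟨$⟩ʳ i) (opposite b)) (opposite a <ᶠ? opposite b))
    (trans (does-⇔ (opposite-<⇔ a b) (opposite a <ᶠ? opposite b) (b <ᶠ? a))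
      (sym (does-⇔ (combine-<⇔ i b a) (combine i b <ᶠ? combine i a) (b <ᶠ? a))))
  does-to-combine {m} i a j b | no i≢j
    rewrite dec-false (toℕ (τ ⟨$⟩ʳ i) ≟ⁿ toℕ (τ ⟨$⟩ʳ j)) (i≢j ∘ τ-injective ∘ toℕ-injective)
          | to-combine i a | to-combine j b =
    does-⇔ (combine-<⇔-≢ (orient (s i) a) (orient (s j) b) (i≢j ∘ τ-injective))
      (combine (τ ⟨$⟩ʳ i) (orient (s i) a) <ᶠ? combine (τ ⟨$⟩ʳ j) (orient (s j) b))
      ((τ ⟨$⟩ʳ i) <ᶠ? (τ ⟨$⟩ʳ j))

  does-to : ∀ m x y → does (to m x <ᶠ? to m y) ≡
    below (label (quotient m x)) (label (quotient m y)) (does (x <ᶠ? y)) (does (y <ᶠ? x))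
  does-to m x y with combine-surjective {K} {m} x | combine-surjective {K} {m} y
  ... | i , a , refl | j , b , refl = trans (does-to-combine i a j b)
    (sym (cong₂ (λ i′ j′ → below (label i′) (label j′) (does (combine i a <ᶠ? combine j b)) (does (combine j b <ᶠ? combine i a)))
      (cong proj₁ (remQuot-combine i a)) (cong proj₁ (remQuot-combine j b))))

  induces-inflate : ∀ {k} (σ : Perm k) m (g : Fin k → Fin (K * m)) → Increasing g →
    induces σ (inflate m) g ≡ matches σ (Vec.tabulate (label ∘ quotient {K} m ∘ g))
  induces-inflate σ m g inc = induces-cong σ (inflate m) g _ λ a b → trans (does-to m (g a) (g b)) (
    trans (cong₂ (below (label (quotient {K} m (g a))) (label (quotient {K} m (g b)))) (does-increasing inc a b) (does-increasing inc b a))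
      (sym (cong₂ (λ u v → below u v (does (a <ᶠ? b)) (does (b <ᶠ? a)))
        (lookup∘tabulate (label ∘ quotient {K} m ∘ g) a) (lookup∘tabulate (label ∘ quotient {K} m ∘ g) b))))

  occurrences-inflate : ∀ {k} (σ : Perm k) m →
    occurrences σ (inflate m) ≡ Σsub k (concatMap (replicate m) labels) (indicator ∘ matches σ)
  occurrences-inflate {k} σ m = begin
    occurrences σ (inflate m)
      ≡⟨ length-filter (induces σ (inflate m)) (choose k (K * m)) ⟩
    sum (map (indicator ∘ induces σ (inflate m)) (choose k (K * m)))
      ≡⟨ cong sum (map-cong-local (All.map (λ {g} inc → cong indicator (induces-inflate σ m g inc))
           (choose-increasing k (K * m)))) ⟩
    sum (map (λ g → indicator (matches σ (Vec.tabulate (label ∘ quotient {K} m ∘ g)))) (choose k (K * m)))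
      ≡⟨ cong sum (map-∘ (choose k (K * m))) ⟩
    sum (map (indicator ∘ matches σ) (map (λ g → Vec.tabulate (label ∘ quotient {K} m ∘ g)) (choose k (K * m))))
      ≡⟨ cong (sum ∘ map (indicator ∘ matches σ))
           (trans (map-choose k (K * m) (label ∘ quotient {K} m))
             (cong (subwords k) (tabulate-quotient K m label))) ⟩
    Σsub k (concatMap (replicate m) labels) (indicator ∘ matches σ) ∎
    where open ≡-Reasoning

-- Limit densities of inflations

^-distribʳ-* : ∀ m n k → (m * n) ^ k ≡ m ^ k * n ^ k
^-distribʳ-* m n zero    = refl
^-distribʳ-* m n (suc k) rewrite ^-distribʳ-* m n k =
  solve 4 (λ m n x y → m :* n :* (x :* y) := m :* x :* (n :* y)) refl m n (m ^ k) (n ^ k)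
  where open +-*-Solver

-- This is `(1 + k) ^ i - 1`, defined without truncated subtraction.
excess : ℕ → ℕ → ℕ
excess k zero    = 0
excess k (suc i) = excess k i + k + excess k i * k

-- Every non-constant term in the expansion of `(1 + k / p) ^ i` carries a factor of at most
-- `1 / p`; hence the power is at most `1 + ((1 + k) ^ i - 1) / p`.
p*[p+k]^i≤p^i*[p+excess] : ∀ p k i → 0 < p → p * (p + k) ^ i ≤ p ^ i * (p + excess k i)
p*[p+k]^i≤p^i*[p+excess] p k zero    0<p = ≤-reflexive (solve 1 (λ p → p :* con 1 := con 1 :* (p :+ con 0)) refl p)
  where open +-*-Solver
p*[p+k]^i≤p^i*[p+excess] p k (suc i) 0<p = begin
  p * ((p + k) * (p + k) ^ i)           ≡⟨ solve 3 (λ p q r → p :* (q :* r) := (p :* r) :* q) refl p (p + k) ((p + k) ^ i) ⟩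
  p * (p + k) ^ i * (p + k)             ≤⟨ *-monoˡ-≤ (p + k) (p*[p+k]^i≤p^i*[p+excess] p k i 0<p) ⟩
  p ^ i * (p + c) * (p + k)             ≡⟨ solve 4 (λ q p c k → q :* (p :+ c) :* (p :+ k) :=
                                             q :* (p :* (p :+ (c :+ k)) :+ c :* k)) refl (p ^ i) p c k ⟩
  p ^ i * (p * (p + (c + k)) + c * k)   ≤⟨ *-monoʳ-≤ (p ^ i) (+-monoʳ-≤ (p * (p + (c + k))) (m≤n*m (c * k) p)) ⟩
  p ^ i * (p * (p + (c + k)) + p * (c * k))
                                        ≡⟨ solve 4 (λ q p c k → q :* (p :* (p :+ (c :+ k)) :+ p :* (c :* k)) :=
                                             p :* q :* (p :+ (c :+ k :+ c :* k))) refl (p ^ i) p c k ⟩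
  p * p ^ i * (p + (c + k + c * k))     ∎
  where
  open ≤-Reasoning
  open +-*-Solver
  c = excess k i
  instance _ = >-nonZero 0<p

module _ {K : ℕ} (τ : Perm (suc K)) (s : Fin (suc K) → Bool) where

  open Inflation τ s

  weight : ∀ {k} → Perm k → ℕ
  weight {k} σ = Σmultiset k labels (indicator ∘ matches σ)

  density-inflate : ∀ {k} (σ : Perm k) {w} → weight σ ≡ w →
    (λ m → density σ (inflate m)) ⟶ ratio w (suc K ^ k)
  -- `ratio` computes only at a successor denominator, so the power is exposed as `suc d`; `D≡`
  -- retains its value for the bounds on `N`.
  density-inflate {k} σ refl with suc K ^ k in D≡
  ... | zero  = contradiction D≡ (≢-nonZero⁻¹ (suc K ^ k) ⦃ m^n≢0 (suc K) k ⦄)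
  ... | suc d = ratio-⟶ (λ m → occurrences σ (inflate m)) (λ m → (suc K * m) C k) w d c k positive upper lower
    where
    open ≤-Reasoning
    open +-*-Solver
    w c D : ℕ
    w = weight σ
    -- The shift of the base and the exponent are both `k`.
    c = excess k k
    D = suc d
    occ N : ℕ → ℕ
    occ p = occurrences σ (inflate (p + k))
    N p = (suc K * (p + k)) C k

    occ≤ : ∀ p → k ! * occ p ≤ (p + k) ^ k * w
    occ≤ p = subst (λ z → k ! * z ≤ (p + k) ^ k * w) (sym (occurrences-inflate σ (p + k)))
      (Σsub-upper (p + k) labels k (indicator ∘ matches σ))

    occ≥ : ∀ p → p ^ k * w ≤ k ! * occ p
    occ≥ p = subst (λ z → p ^ k * w ≤ k ! * z) (sym (occurrences-inflate σ (p + k)))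
      (Σsub-lower p (p + k) labels k (indicator ∘ matches σ) ≤-refl)

    N≤ : ∀ p → k ! * N p ≤ D * (p + k) ^ k
    N≤ p = ≤-trans (!*C≤^ (suc K * (p + k)) k)
      (≤-reflexive (trans (^-distribʳ-* (suc K) (p + k) k) (cong (_* (p + k) ^ k) D≡)))

    N≥ : ∀ p → D * p ^ k ≤ k ! * N p
    N≥ p = ≤-trans (≤-reflexive (trans (cong (_* p ^ k) (sym D≡)) (sym (^-distribʳ-* (suc K) p k))))
      (^≤!*C (suc K * p) (suc K * (p + k)) k
        (≤-trans (+-monoʳ-≤ (suc K * p) (m≤n*m k (suc K))) (≤-reflexive (sym (*-distribˡ-+ (suc K) p k)))))

    instance _ = k !≢0

    positive : ∀ p → 0 < p → 0 < N p
    positive p 0<p = n≢0⇒n>0 λ N≡0 → <-irrefl refl (begin-strict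
      0              <⟨ *-mono-≤ (s≤s {n = d} z≤n) (m^n>0 p ⦃ >-nonZero 0<p ⦄ k) ⟩
      D * p ^ k      ≤⟨ N≥ p ⟩
      k ! * N p      ≡⟨ cong (k ! *_) N≡0 ⟩
      k ! * 0        ≡⟨ *-zeroʳ (k !) ⟩
      0              ∎)

    upper : ∀ p → 0 < p → occ p * D * p ≤ w * (p + c) * N p
    upper p 0<p = *-cancelˡ-≤ (k !) (begin
      k ! * (occ p * D * p)           ≡⟨ solve 4 (λ f o d p → f :* (o :* d :* p) := f :* o :* (d :* p)) refl (k !) (occ p) D p ⟩
      k ! * occ p * (D * p)           ≤⟨ *-monoˡ-≤ (D * p) (occ≤ p) ⟩
      (p + k) ^ k * w * (D * p)       ≡⟨ solve 4 (λ q w d p → q :* w :* (d :* p) := w :* d :* (p :* q)) refl ((p + k) ^ k) w D p ⟩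
      w * D * (p * (p + k) ^ k)       ≤⟨ *-monoʳ-≤ (w * D) (p*[p+k]^i≤p^i*[p+excess] p k k 0<p) ⟩
      w * D * (p ^ k * (p + c))       ≡⟨ solve 4 (λ w d q r → w :* d :* (q :* r) := w :* r :* (d :* q)) refl w D (p ^ k) (p + c) ⟩
      w * (p + c) * (D * p ^ k)       ≤⟨ *-monoʳ-≤ (w * (p + c)) (N≥ p) ⟩
      w * (p + c) * (k ! * N p)       ≡⟨ solve 3 (λ v f n → v :* (f :* n) := f :* (v :* n)) refl (w * (p + c)) (k !) (N p) ⟩
      k ! * (w * (p + c) * N p)       ∎)

    lower : ∀ p → 0 < p → w * p * N p ≤ occ p * D * (p + c)
    lower p 0<p = *-cancelˡ-≤ (k !) (begin
      k ! * (w * p * N p)             ≡⟨ solve 3 (λ f v n → f :* (v :* n) := v :* (f :* n)) refl (k !) (w * p) (N p) ⟩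
      w * p * (k ! * N p)             ≤⟨ *-monoʳ-≤ (w * p) (N≤ p) ⟩
      w * p * (D * (p + k) ^ k)       ≡⟨ solve 4 (λ w p d q → w :* p :* (d :* q) := w :* d :* (p :* q)) refl w p D ((p + k) ^ k) ⟩
      w * D * (p * (p + k) ^ k)       ≤⟨ *-monoʳ-≤ (w * D) (p*[p+k]^i≤p^i*[p+excess] p k k 0<p) ⟩
      w * D * (p ^ k * (p + c))       ≡⟨ solve 4 (λ w d q r → w :* d :* (q :* r) := q :* w :* (d :* r)) refl w D (p ^ k) (p + c) ⟩
      p ^ k * w * (D * (p + c))       ≤⟨ *-monoˡ-≤ (D * (p + c)) (occ≥ p) ⟩
      k ! * occ p * (D * (p + c))     ≡⟨ solve 4 (λ f o d r → f :* o :* (d :* r) := f :* (o :* d :* r)) refl (k !) (occ p) D (p + c) ⟩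
      k ! * (occ p * D * (p + c))     ∎)

-- The 48-block counterexample

-- Found by computer search.
blocks : Vec Label 48
blocks =
  (37 , true) ∷ (30 , false) ∷ (40 , true) ∷ (35 , true) ∷ (26 , true) ∷ (28 , true) ∷
  (22 , false) ∷ (2 , false) ∷ (13 , true) ∷ (31 , false) ∷ (0 , false) ∷ (27 , false) ∷
  (3 , false) ∷ (39 , false) ∷ (23 , true) ∷ (29 , false) ∷ (9 , true) ∷ (1 , true) ∷
  (15 , true) ∷ (5 , false) ∷ (11 , true) ∷ (4 , false) ∷ (41 , true) ∷ (33 , false) ∷
  (14 , false) ∷ (6 , true) ∷ (43 , false) ∷ (36 , true) ∷ (42 , false) ∷ (32 , true) ∷
  (46 , true) ∷ (38 , true) ∷ (18 , false) ∷ (24 , true) ∷ (8 , false) ∷ (44 , false) ∷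
  (20 , false) ∷ (47 , false) ∷ (16 , false) ∷ (34 , true) ∷ (45 , false) ∷ (25 , false) ∷
  (19 , true) ∷ (21 , true) ∷ (12 , true) ∷ (7 , true) ∷ (17 , false) ∷ (10 , true) ∷
  []

value : Fin 48 → Fin 48
value i = proj₁ (lookup blocks i) mod 48

-- The diagram is invariant under rotation by 90°: with (x , y) it contains
-- (47 ∸ y , x), so the inverse of value is value ∘ opposite.  As the rotation
-- exchanges 1234 with 4321 and 2143 with 3412, only two of the four equations
-- for the weights were independent in the search.
τ : Perm 48
τ = permutation value (value ∘ opposite)
  (toWitness {a? = all? λ i → value (value (opposite i)) ≟ᶠ i} _)
  (toWitness {a? = all? λ i → value (opposite (value i)) ≟ᶠ i} _)

increasing? : Fin 48 → Bool
increasing? i = proj₂ (lookup blocks i)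

open Inflation τ increasing?

-- Keeps the lookups and the reductions modulo 48 out of the evaluation of weights.
labels≡blocks : labels ≡ Vec.toList blocks
labels≡blocks = refl

weight≡ : ∀ {k} (σ : Perm k) {w} → Σmultiset k (Vec.toList blocks) (indicator ∘ matches σ) ≡ w →
  weight τ increasing? σ ≡ w
weight≡ {k} σ = trans (cong (λ l → Σmultiset k l (indicator ∘ matches σ)) labels≡blocks)

weight-1234 : weight τ increasing? p1234 ≡ 221184
weight-1234 = weight≡ p1234 refl

weight-2143 : weight τ increasing? p2143 ≡ 221184
weight-2143 = weight≡ p2143 refl

weight-3412 : weight τ increasing? p3412 ≡ 221184
weight-3412 = weight≡ p3412 refl

weight-4321 : weight τ increasing? p4321 ≡ 221184
weight-4321 = weight≡ p4321 refl

p123 : Perm 3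
p123 = involution (λ i → i) (λ _ → refl)

-- As 48³ / 6 = 18432, the surplus is 48, and the limit density of 123 is 1/6 + 1/2304.
weight-123 : weight τ increasing? p123 ≡ 18480
weight-123 = weight≡ p123 refl

inflate-cross : (σ : Σ ℕ Perm) → σ ∈ S-cross →
  (λ m → density (proj₂ σ) (inflate m)) ⟶ ratio 1 (proj₁ σ !)
-- Rationals are kept in lowest terms, so `ratio 221184 (48 ^ 4)` and `ratio 1 (4 !)` agree by
-- computation.
inflate-cross _ (here refl)                         = density-inflate τ increasing? p1234 weight-1234
inflate-cross _ (there (here refl))                 = density-inflate τ increasing? p2143 weight-2143
inflate-cross _ (there (there (here refl)))         = density-inflate τ increasing? p3412 weight-3412
inflate-cross _ (there (there (there (here refl)))) = density-inflate τ increasing? p4321 weight-4321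

theorem16 : ¬ QuasirandomForcing S-cross
theorem16 forcing = toWitnessFalse {a? = ratio 1 6 ℚₚ.≟ ratio 18480 (48 ^ 3)} _ (⟶-unique
  (λ m → density p123 (inflate m))
  (forcing (48 *_) inflate (λ M → M , λ m M≤m → ≤-trans M≤m (m≤n*m m 48)) inflate-cross 3 p123)
  (density-inflate τ increasing? p123 weight-123))
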